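{- If $D$ is a digraph such that $P(D)$ has a unique maximal element and $w(P(D))\ge 2$, then $l^*(D)=w(P(D))$.
   Context: A digraph $D$ is finite with nonempty vertex set $V(D)$; loops are allowed, no multiple edges. Trees are finite; a leaf is a vertex of degree 1. Subtrees are nonempty connected subgraphs. A catch-tree representation of $D$ in a host tree $T$ assigns to each vertex $v$ of $D$ a subtree $S_v$ of $T$ (source subtree) and a single vertex $t_v$ of $T$ (sink point) such that, for all $u,v\in V(D)$ (including $u=v$), $uv$ is an edge of $D$ if and only if $t_v\in S_u$. The catch leafage $l^*(D)$ is the minimum number of leaves of a host tree in which $D$ has a catch-tree representation. The incidence poset $P(D)$ is the collection of predecessor sets $N^-(v)=\{u\in V(D): uv\in E(D)\}$, $v\in V(D)$, ordered by inclusion (these are the sets whose incidence vectors are the columns of the adjacency matrix; equal sets give one element). The width $w(P)$ of a poset $P$ is the maximum size of an antichain in $P$. -}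

module Defs where

open import Level using (Level; 0ℓ; _⊔_)
open import Data.Bool using (Bool; T)
open import Data.Fin using (Fin)
open import Data.Fin.Subset using (Subset; Nonempty; ∣_∣; _∈_)
open import Data.Fin.Subset.Properties using (⊆-poset)
open import Data.List using (List; _∷_; _∷ʳ_; allFin; filter; length)
open import Data.List.Relation.Unary.Linked using (Linked)
open import Data.List.Relation.Unary.Unique.Propositional using (Unique)
open import Data.Nat using (ℕ; NonZero; _≤_; _≟_)
open import Data.Product using (Σ; ∃; ∃-syntax; ∃!; _×_; proj₁)
open import Data.Vec using (tabulate)
open import Function.Bundles using (_⇔_)
open import Relation.Binary.Bundles using (Poset)
open import Relation.Binary.Construct.Closure.ReflexiveTransitive using (Star)
import Relation.Binary.Construct.On as On
open import Relation.Binary.Core using (Rel)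
open import Relation.Binary.Definitions using (Irreflexive; Symmetric)
open import Relation.Binary.PropositionalEquality using (_≡_; _≢_)
open import Relation.Nullary using (¬_)

------------------------------------------------------------------------
-- Posets

module _ {c ℓ₁ ℓ₂ : Level} (P : Poset c ℓ₁ ℓ₂) where
  open Poset P using (Carrier; _≈_) renaming (_≤_ to _≼_)

  IsMaximal : Carrier → Set (c ⊔ ℓ₁ ⊔ ℓ₂)
  IsMaximal x = ∀ y → x ≼ y → x ≈ y

  HasUniqueMaximal : Set (c ⊔ ℓ₁ ⊔ ℓ₂)
  HasUniqueMaximal = ∃! _≈_ IsMaximal

  -- An antichain of size k, listed without repetition: by reflexivity of
  -- _≼_, the members at distinct indices are also distinct up to _≈_.
  Antichain : ℕ → Set (c ⊔ ℓ₂)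
  Antichain k = Σ (Fin k → Carrier) λ a → ∀ {i j} → i ≢ j → ¬ (a i ≼ a j)

  -- k is the width, i.e. the maximum size of an antichain.
  IsWidth : ℕ → Set (c ⊔ ℓ₂)
  IsWidth k = Antichain k × (∀ j → Antichain j → j ≤ k)

------------------------------------------------------------------------
-- Digraphs and their incidence posets

record Digraph : Set where
  field
    order        : ℕ
    {{nonempty}} : NonZero order
    edge         : Fin order → Fin order → Bool

  Vertex : Set
  Vertex = Fin order

  Edge : Rel Vertex 0ℓ
  Edge u v = T (edge u v)

  N⁻ : Vertex → Subset order
  N⁻ v = tabulate λ u → edge u v

-- Elements are compared only through their underlying sets: vertices with
-- equal predecessor sets give one element up to the poset's equality.
incidencePoset : Digraph → Poset 0ℓ 0ℓ 0ℓ
incidencePoset D = On.poset (⊆-poset order) (proj₁ {B = IsPredecessorSet})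
  where
  open Digraph D
  IsPredecessorSet : Subset order → Set
  IsPredecessorSet X = ∃[ v ] X ≡ N⁻ v

------------------------------------------------------------------------
-- Trees

record Graph : Set where
  field
    order : ℕ
    adj   : Fin order → Fin order → Bool

  Vertex : Set
  Vertex = Fin order

  Adj : Rel Vertex 0ℓ
  Adj x y = T (adj x y)

  field
    symmetric   : Symmetric Adj
    irreflexive : Irreflexive _≡_ Adj

  degree : Vertex → ℕ
  degree x = ∣ tabulate (adj x) ∣

  leafCount : ℕ
  leafCount = length (filter (λ x → degree x ≟ 1) (allFin order))

  Connected : Set
  Connected = ∀ x y → Star Adj x y

  -- A cycle through the distinct vertices x, y, z, zs, in this order and
  -- back to x; its length is at least three.
  IsCycle : Vertex → Vertex → Vertex → List Vertex → Set
  IsCycle x y z zs = Unique (x ∷ y ∷ z ∷ zs) × Linked Adj (x ∷ y ∷ z ∷ zs ∷ʳ x)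

  Acyclic : Set
  Acyclic = ∀ x y z zs → ¬ IsCycle x y z zs

record Tree : Set where
  field
    graph : Graph

  open Graph graph public

  field
    {{nonempty}} : NonZero order
    connected    : Connected
    acyclic      : Acyclic

record Subtree (H : Tree) : Set where
  private module H = Tree H
  field
    vertices : Subset H.order
    adj      : H.Vertex → H.Vertex → Bool

  Adj : Rel H.Vertex 0ℓ
  Adj x y = T (adj x y)

  field
    symmetric : Symmetric Adj
    adj⇒∈     : ∀ {x y} → Adj x y → x ∈ vertices
    adj⇒adj   : ∀ {x y} → Adj x y → H.Adj x y
    nonempty  : Nonempty vertices
    connected : ∀ {x y} → x ∈ vertices → y ∈ vertices → Star Adj x y

------------------------------------------------------------------------
-- Catch-tree representations

record CatchRepresentation (D : Digraph) (H : Tree) : Set where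
  open Digraph D
  field
    source : Vertex → Subtree H
    sink   : Vertex → Tree.Vertex H
    catch  : ∀ u v → Edge u v ⇔ (sink v ∈ Subtree.vertices (source u))

-- k is the minimum number of leaves of a host tree for D.
IsCatchLeafage : Digraph → ℕ → Set
IsCatchLeafage D k =
  (∃[ H ] CatchRepresentation D H × Tree.leafCount H ≡ k) ×
  (∀ H → CatchRepresentation D H → k ≤ Tree.leafCount H)

{-# OPTIONS --safe #-}
-- Lower bound: root the host tree at the sink r of the greatest predecessor
-- set.  A subtree caught at a sink t is also caught at r, so it contains the
-- path from r to t, and a sink on this path has a larger predecessor set.
-- Hence the paths from r through the sinks of an antichain, continued until
-- they reach a leaf, end in different leaves.
--
-- Upper bound: by Dilworth's theorem the predecessor sets are covered by w
-- chains.  Put each chain on a leg of a spider, larger sets closer to the body,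
-- and let the source subtree of u be the body together with the part of each
-- leg up to the outermost sink whose predecessor set contains u.
module Submission where

open import Defs
open import Level using (0ℓ)
open import Data.Bool using (Bool; T; if_then_else_)
open import Data.Bool.Properties using (T?; T-≡)
open import Data.Empty using (⊥; ⊥-elim)
open import Data.Fin as Fin using (Fin; zero; suc; toℕ; fromℕ<; inject≤; punchOut; finToFun; funToFin)
import Data.Fin.Induction as Fin
open import Data.Fin.Properties using (_≟_; any?; all?; toℕ<n; toℕ-injective; toℕ-fromℕ<; fromℕ<-injective; injective⇒≤; punchOut-injective; inject≤-injective; finToFun-funToFin)
open import Data.Fin.Subset using (⁅_⁆; ∣_∣; _⊆_) renaming (_∈_ to _∈ˢ_)
open import Data.Fin.Subset.Properties using (x∈⁅x⁆; x∈⁅y⁆⇒x≡y; ∣⁅x⁆∣≡1; ⊆-refl; ⊆-trans; ⊆-antisym; _⊆?_; ∣p∣≤n; p⊂q⇒∣p∣<∣q∣) renaming (_∈?_ to _∈ˢ?_)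
open import Data.List using (List; []; _∷_; _++_; _∷ʳ_; _ʳ++_; allFin; filter; length; lookup)
open import Data.List.Properties using (filter-notAll; ∷-injectiveʳ; ∷ʳ-++)
open import Data.List.Membership.Propositional using (_∈_; lose)
open import Data.List.Membership.Propositional.Properties using (∈-allFin; ∈-filter⁺; ∈-filter⁻; ∈-lookup; ∈-∃++; ∈-++⁺ʳ)
open import Data.List.Membership.Setoid.Properties using (index-injective)
open import Data.List.Relation.Unary.All as All using (All; []; _∷_)
open import Data.List.Relation.Unary.All.Properties using (++⁻; ¬Any⇒All¬)
open import Data.List.Relation.Unary.AllPairs using ([]; _∷_)
open import Data.List.Relation.Unary.Any using (here; there)
open import Data.List.Relation.Unary.Linked using (Linked; [-]; _∷_)
open import Data.List.Relation.Unary.Unique.Propositional using (Unique)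
open import Data.List.Relation.Unary.Unique.Propositional.Properties using (allFin⁺; filter⁺)
open import Data.Nat as ℕ using (ℕ; zero; suc; pred; _+_; _*_; _∸_; _≤_; _<_; s≤s; z≤n; NonZero)
open import Data.Nat.DivMod using (_%_; [m+kn]%n≡m%n; [m+n]%n≡m%n; m<n⇒m%n≡m)
open import Data.Nat.Induction using (<-wellFounded)
import Data.Nat.Properties as ℕ
open import Data.Product using (∃; ∃-syntax; _×_; _,_; proj₁; proj₂)
open import Data.Sum using (_⊎_; inj₁; inj₂; swap)
open import Data.Unit using (⊤)
open import Data.Vec using (tabulate)
open import Data.Vec.Properties using (lookup⇒[]=; []=⇒lookup; lookup∘tabulate)
open import Function using (_∘_; id)
open import Function.Bundles using (mk⇔; module Equivalence)
open import Induction.WellFounded using (Acc; acc)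
open import Relation.Binary.Bundles using (Poset)
import Relation.Binary.Construct.Closure.ReflexiveTransitive as Star
open import Relation.Binary.Core using (Rel)
import Relation.Binary.Definitions as B
open import Relation.Binary.PropositionalEquality using (_≡_; _≢_; refl; sym; trans; cong; subst; subst₂; setoid)
open import Relation.Nullary using (¬_; Dec; yes; no; does; contradiction)
open import Relation.Nullary.Decidable using (¬?; _×-dec_; _⊎-dec_; _→-dec_; map′; decidable-stable; isYes; toWitness; fromWitness)
open import Relation.Unary using (Pred; Decidable)
open Equivalence using (to; from)
open Star using (Star; ε; _◅_; _◅◅_)

private variable
  n k : ℕ

-- Dilworth's theorem

-- If `j` were missed, punching it out would inject `Fin (suc k)` into `Fin k`.
injective⇒hits-all : ∀ {k} (f : Fin k → ℕ) → (∀ i → f i < k) →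
  (∀ {i j} → f i ≡ f j → i ≡ j) → ∀ (j : Fin k) → ∃[ i ] f i ≡ toℕ j
injective⇒hits-all {suc k} f f< inj j with any? (λ i → f i ℕ.≟ toℕ j)
... | yes hit = hit
... | no miss = contradiction (injective⇒≤ g-injective) ℕ.1+n≰n
  where
  f′ : Fin (suc k) → Fin (suc k)
  f′ i = fromℕ< (f< i)
  f′≡ : ∀ i → toℕ (f′ i) ≡ f i
  f′≡ i = toℕ-fromℕ< (f< i)
  j≢f′ : ∀ i → j ≢ f′ i
  j≢f′ i refl = miss (i , sym (f′≡ i))
  g-injective : ∀ {i i′} → punchOut (j≢f′ i) ≡ punchOut (j≢f′ i′) → i ≡ i′
  g-injective {i} {i′} eq = inj (trans (sym (f′≡ i))
    (trans (cong toℕ (punchOut-injective (j≢f′ i) (j≢f′ i′) eq)) (f′≡ i′)))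

-- The search runs over the finitely many codes of functions. Decoding a code recovers a function
-- only pointwise, hence the condition that `P` respects pointwise equality.
anyFun? : ∀ {m n} {P : Pred (Fin m → Fin n) 0ℓ} →
  (∀ {f g} → (∀ i → f i ≡ g i) → P f → P g) → Decidable P → Dec (∃ P)
anyFun? {m} {n} resp P? = map′
  (λ (code , p) → finToFun code , p)
  (λ (f , p) → funToFin f , resp (sym ∘ finToFun-funToFin f) p)
  (any? (P? ∘ finToFun))

module FinitePreorder {n : ℕ} {_≼_ : Rel (Fin n) 0ℓ} (_≼?_ : B.Decidable _≼_)
  (≼-refl : B.Reflexive _≼_) (≼-trans : B.Transitive _≼_) where

  open import Data.List.Membership.DecPropositional (_≟_ {n = n}) using (_∈?_)

  maximal : ∀ {Q : Pred (Fin n) 0ℓ} → Decidable Q → ∃ Q → (xs : List (Fin n)) →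
    ∃[ m ] Q m × (∀ {y} → y ∈ xs → Q y → m ≼ y → y ≼ m)
  maximal Q? (x , qx) [] = x , qx , λ ()
  maximal Q? q (y ∷ ys) with maximal Q? q ys
  ... | m , qm , max with Q? y ×-dec (m ≼? y)
  ... | yes (qy , m≼y) = y , qy , λ where
    (here refl) _ _ → ≼-refl
    (there z∈) qz y≼z → ≼-trans (max z∈ qz (≼-trans m≼y y≼z)) m≼y
  ... | no ¬q = m , qm , λ where
    (here refl) qy m≼y → contradiction (qy , m≼y) ¬q
    (there z∈) → max z∈

  Comparable : Rel (Fin n) 0ℓ
  Comparable x y = x ≼ y ⊎ y ≼ x

  IsAntichainIn : ∀ {k} → List (Fin n) → (Fin k → Fin n) → Set
  IsAntichainIn xs a = (∀ i → a i ∈ xs) × (∀ i j → i ≢ j → ¬ a i ≼ a j)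

  isAntichainIn? : ∀ {k} xs → Decidable (IsAntichainIn {k} xs)
  isAntichainIn? xs a =
    all? (λ i → a i ∈? xs) ×-dec
    all? (λ i → all? (λ j → ¬? (i ≟ j) →-dec ¬? (a i ≼? a j)))

  isAntichainIn-resp : ∀ {k} xs {a b : Fin k → Fin n} → (∀ i → a i ≡ b i) →
    IsAntichainIn xs a → IsAntichainIn xs b
  isAntichainIn-resp xs a≗b (a∈ , anti) =
    (λ i → subst (_∈ xs) (a≗b i) (a∈ i)) ,
    λ i j i≢j → anti i j i≢j ∘ subst₂ _≼_ (sym (a≗b i)) (sym (a≗b j))

  -- c x is the index of the chain of x; its values off xs are irrelevant.
  IsChainCover : List (Fin n) → ℕ → (Fin n → ℕ) → Set
  IsChainCover xs k c = (∀ {x} → x ∈ xs → c x < k) ×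
    (∀ {x y} → x ∈ xs → y ∈ xs → c x ≡ c y → Comparable x y)

  -- Two members on one chain would be comparable, so the chain index is injective on the antichain
  -- and pigeonhole applies.
  antichain-meets-chains : ∀ {xs k c} {a : Fin k → Fin n} → IsChainCover xs k c →
    IsAntichainIn xs a → ∀ (j : Fin k) → ∃[ i ] c (a i) ≡ toℕ j
  antichain-meets-chains {c = c} {a} (c< , chain) (a∈ , anti) =
    injective⇒hits-all (c ∘ a) (c< ∘ a∈) same
    where
    same : ∀ {i j} → c (a i) ≡ c (a j) → i ≡ j
    same {i} {j} eq with i ≟ j
    ... | yes i≡j = i≡j
    ... | no i≢j with chain (a∈ i) (a∈ j) eq
    ... | inj₁ i≼j = contradiction i≼j (anti i j i≢j)
    ... | inj₂ j≼i = contradiction j≼i (anti j i (i≢j ∘ sym))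

  module _ {K : Pred (Fin n) 0ℓ} (K? : Decidable K) where

    without : List (Fin n) → List (Fin n)
    without = filter (¬? ∘ K?)

    recolour : ℕ → (Fin n → ℕ) → Fin n → ℕ
    recolour k c x = if does (K? x) then k else c x

    -- The members of `K` get the fresh index `k`; all old indices are smaller, so the new chain is
    -- not mixed with an old one.
    add-chain : ∀ {xs k c} → (∀ {x y} → x ∈ xs → y ∈ xs → K x → K y → Comparable x y) →
      IsChainCover (without xs) k c → IsChainCover xs (suc k) (recolour k c)
    add-chain {xs} {k} {c} K-chain (c< , chain) = bound , comparable
      where
      bound : ∀ {x} → x ∈ xs → recolour k c x < suc k
      bound {x} x∈ with K? x
      ... | yes _ = ℕ.≤-refl
      ... | no ¬Kx = ℕ.m<n⇒m<1+n (c< (∈-filter⁺ (¬? ∘ K?) x∈ ¬Kx))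
      comparable : ∀ {x y} → x ∈ xs → y ∈ xs → recolour k c x ≡ recolour k c y → Comparable x y
      comparable {x} {y} x∈ y∈ eq with K? x | K? y
      ... | yes Kx | yes Ky = K-chain x∈ y∈ Kx Ky
      ... | yes _ | no ¬Ky = contradiction (sym eq) (ℕ.<⇒≢ (c< (∈-filter⁺ (¬? ∘ K?) y∈ ¬Ky)))
      ... | no ¬Kx | yes _ = contradiction eq (ℕ.<⇒≢ (c< (∈-filter⁺ (¬? ∘ K?) x∈ ¬Kx)))
      ... | no ¬Kx | no ¬Ky = chain (∈-filter⁺ (¬? ∘ K?) x∈ ¬Kx) (∈-filter⁺ (¬? ∘ K?) y∈ ¬Ky) eq

  -- The common size `k` makes the antichain maximum and the cover minimum.
  Dilworth : List (Fin n) → Set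
  Dilworth xs = ∃[ k ] (∃ (IsAntichainIn {k} xs)) × (∃ (IsChainCover xs k))

  -- Galvin's induction: remove a maximal element t, and let top j be the
  -- highest element of the j-th chain lying on a maximum antichain of the
  -- rest.  The tops form an antichain; if t is above none of them it extends
  -- this antichain, and if t is above top j then removing t together with
  -- the part of chain j below top j decreases the width.
  module GalvinStep {xs t} (t∈ : t ∈ xs) (t-max : ∀ {y} → y ∈ xs → t ≼ y → y ≼ t)
    (rec : ∀ ys → length ys < length xs → Dilworth ys) where

    rest : List (Fin n)
    rest = without (_≟ t) xs

    removes : ∀ {K : Pred (Fin n) 0ℓ} (K? : Decidable K) → K t → length (without K? xs) < length xs
    removes K? Kt = filter-notAll (¬? ∘ K?) xs (lose t∈ λ ¬Kt → ¬Kt Kt)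

    rest⊆ : ∀ {x} → x ∈ rest → x ∈ xs
    rest⊆ = proj₁ ∘ ∈-filter⁻ (¬? ∘ (_≟ t)) {xs = xs}

    module _ {k} {a : Fin k → Fin n} (a-anti : IsAntichainIn rest a)
      {c} (cover : IsChainCover rest k c) where

      High : Fin k → Pred (Fin n) 0ℓ
      High j x = c x ≡ toℕ j × ∃[ b ] IsAntichainIn {k} rest b × ∃[ i ] b i ≡ x

      high? : ∀ j → Decidable (High j)
      high? j x = (c x ℕ.≟ toℕ j) ×-dec anyFun?
        (λ b≗b′ (anti , i , eq) → isAntichainIn-resp rest b≗b′ anti , i , trans (sym (b≗b′ i)) eq)
        (λ b → isAntichainIn? rest b ×-dec any? (λ i → b i ≟ x))

      member : ∀ j {b} → IsAntichainIn {k} rest b → ∃[ i ] High j (b i)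
      member j {b} anti with antichain-meets-chains cover anti j
      ... | i , eq = i , eq , b , anti , i , refl

      abstract
        highest : ∀ j → ∃[ m ] High j m × (∀ {y} → y ∈ rest → High j y → m ≼ y → y ≼ m)
        highest j = maximal (high? j) (_ , proj₂ (member j a-anti)) rest

      top : Fin k → Fin n
      top j = proj₁ (highest j)

      high∈rest : ∀ {j x} → High j x → x ∈ rest
      high∈rest (_ , _ , (b∈ , _) , i , eq) = subst (_∈ rest) eq (b∈ i)

      top-high : ∀ j → High j (top j)
      top-high j = proj₁ (proj₂ (highest j))

      top∈rest : ∀ j → top j ∈ rest
      top∈rest j = high∈rest (top-high j)

      high≼top : ∀ {j x} → High j x → x ≼ top j
      high≼top {j} {x} hx with proj₂ cover (high∈rest hx) (top∈rest j) (trans (proj₁ hx) (sym (proj₁ (top-high j))))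
      ... | inj₁ x≼top = x≼top
      ... | inj₂ top≼x = proj₂ (proj₂ (highest j)) (high∈rest hx) hx top≼x

      -- An antichain `b` through `top j` meets chain `i` in a high element, which lies below
      -- `top i`. If `top i ≼ top j`, two members of `b` are comparable, so they coincide and the
      -- two chains are the same.
      tops-incomparable : ∀ i j → i ≢ j → ¬ top i ≼ top j
      tops-incomparable i j i≢j topᵢ≼topⱼ with top-high j
      ... | cⱼ , b , anti , l , bl≡top with member i anti
      ... | m , hm with m ≟ l
      ... | yes refl = i≢j (toℕ-injective (trans (sym (proj₁ hm)) (trans (cong c bl≡top) cⱼ)))
      ... | no m≢l = proj₂ anti m l m≢l
        (≼-trans (high≼top hm) (subst (top i ≼_) (sym bl≡top) topᵢ≼topⱼ))

      extended : (∀ j → ¬ top j ≼ t) → Dilworth xs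
      extended no-top = suc k , (a⁺ , a⁺∈ , a⁺-anti) , recolour (_≟ t) k c ,
        add-chain (_≟ t) (λ { _ _ refl refl → inj₁ ≼-refl }) cover
        where
        a⁺ : Fin (suc k) → Fin n
        a⁺ zero    = t
        a⁺ (suc j) = top j
        a⁺∈ : ∀ i → a⁺ i ∈ xs
        a⁺∈ zero    = t∈
        a⁺∈ (suc j) = rest⊆ (top∈rest j)
        a⁺-anti : ∀ i j → i ≢ j → ¬ a⁺ i ≼ a⁺ j
        a⁺-anti zero    zero    i≢j = contradiction refl i≢j
        -- Maximality of `t` turns `t ≼ top j` into the excluded `top j ≼ t`.
        a⁺-anti zero    (suc j) _   = no-top j ∘ t-max (a⁺∈ (suc j))
        a⁺-anti (suc i) zero    _   = no-top i
        a⁺-anti (suc i) (suc j) i≢j = tops-incomparable i j (i≢j ∘ cong suc)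

      shrunk : ∀ j → top j ≼ t → Dilworth xs
      shrunk j top≼t = fromRec (rec remainder (removes K? (inj₁ refl)))
        where
        K : Pred (Fin n) 0ℓ
        K x = x ≡ t ⊎ (c x ≡ toℕ j × x ≼ top j)
        K? : Decidable K
        K? x = (x ≟ t) ⊎-dec ((c x ℕ.≟ toℕ j) ×-dec (x ≼? top j))
        remainder : List (Fin n)
        remainder = without K? xs
        remainder⊆rest : ∀ {x} → x ∈ remainder → x ∈ rest
        remainder⊆rest x∈ with ∈-filter⁻ (¬? ∘ K?) {xs = xs} x∈
        ... | x∈xs , ¬Kx = ∈-filter⁺ (¬? ∘ (_≟ t)) x∈xs (¬Kx ∘ inj₁)
        K-chain : ∀ {x y} → x ∈ xs → y ∈ xs → K x → K y → Comparable x y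
        K-chain _ _ (inj₁ refl) (inj₁ refl) = inj₁ ≼-refl
        K-chain _ _ (inj₁ refl) (inj₂ (_ , y≼)) = inj₂ (≼-trans y≼ top≼t)
        K-chain _ _ (inj₂ (_ , x≼)) (inj₁ refl) = inj₁ (≼-trans x≼ top≼t)
        -- `cover` speaks only of `rest`, and the value `c t` is arbitrary and may happen to be
        -- `toℕ j`, so `t` is treated separately.
        K-chain {x} {y} x∈ y∈ (inj₂ (cx , x≼)) (inj₂ (cy , y≼)) with x ≟ t | y ≟ t
        ... | yes refl | _ = inj₂ (≼-trans y≼ top≼t)
        ... | _ | yes refl = inj₁ (≼-trans x≼ top≼t)
        ... | no x≢t | no y≢t = proj₂ cover (∈-filter⁺ (¬? ∘ (_≟ t)) x∈ x≢t)
          (∈-filter⁺ (¬? ∘ (_≟ t)) y∈ y≢t) (trans cx (sym cy))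
        fromRec : Dilworth remainder → Dilworth xs
        fromRec (k′ , (b , b∈ , b-anti) , c′ , cover′) with k ℕ.≤? k′
        -- The first `k` members of `b` form an antichain of `rest`, so one of them is high on chain
        -- `j`. It lies below `top j` and has therefore been removed.
        ... | yes k≤k′ = ⊥-elim (proj₂ (∈-filter⁻ (¬? ∘ K?) {xs = xs} (b∈ (inject≤ i k≤k′))) (inj₂ (proj₁ hi , high≼top hi)))
          where
          hit : ∃[ i ] High j (b (inject≤ i k≤k′))
          hit = member j {b ∘ λ i → inject≤ i k≤k′}
            ( (λ i → remainder⊆rest (b∈ _))
            , λ i i′ i≢i′ → b-anti _ _ (i≢i′ ∘ inject≤-injective k≤k′ k≤k′ i i′))
          i = proj₁ hit
          hi = proj₂ hit
        ... | no k≰k′ with add-chain K? {xs} K-chain cover′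
        ... | bound , comparable = k , (a , rest⊆ ∘ proj₁ a-anti , proj₂ a-anti) ,
          recolour K? k′ c′ , (λ x∈ → ℕ.≤-trans (bound x∈) (ℕ.≰⇒> k≰k′)) , comparable

      step : Dilworth xs
      step with any? (λ j → top j ≼? t)
      ... | yes (j , top≼t) = shrunk j top≼t
      ... | no none = extended λ j top≼t → none (j , top≼t)

    dilworth-step : Dilworth xs
    dilworth-step with rec rest (removes (_≟ t) refl)
    ... | _ , (_ , a-anti) , _ , cover = step a-anti cover

  dilworth : ∀ xs → Dilworth xs
  dilworth xs = go xs (<-wellFounded (length xs))
    where
    go : ∀ xs → Acc _<_ (length xs) → Dilworth xs
    go [] _ = 0 , ((λ ()) , (λ ()) , λ ()) , (λ _ → 0) , (λ ()) , λ ()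
    go xs@(x ∷ _) (acc rs) with maximal (_∈? xs) (x , here refl) xs
    ... | t , t∈ , t-max = GalvinStep.dilworth-step t∈
      (λ y∈ → t-max y∈ y∈) (λ ys ys< → go ys (rs ys<))

-- Finite counting and lists

∈-tabulate⁺ : ∀ {f : Fin n → Bool} {i} → T (f i) → i ∈ˢ tabulate f
∈-tabulate⁺ {f = f} {i} Tfi = lookup⇒[]= i _ (trans (lookup∘tabulate f i) (to T-≡ Tfi))

∈-tabulate⁻ : ∀ {f : Fin n → Bool} {i} → i ∈ˢ tabulate f → T (f i)
∈-tabulate⁻ {f = f} {i} i∈ = from T-≡ (trans (sym (lookup∘tabulate f i)) ([]=⇒lookup i∈))

lookup-injective : ∀ {A : Set} {xs : List A} → Unique xs →
  ∀ {i j} → lookup xs i ≡ lookup xs j → i ≡ j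
lookup-injective (_ ∷ _) {zero} {zero} _ = refl
lookup-injective {xs = _ ∷ xs} (x∉ ∷ _) {zero} {suc j} eq = contradiction eq (All.lookup x∉ (∈-lookup j))
lookup-injective {xs = _ ∷ xs} (x∉ ∷ _) {suc i} {zero} eq = contradiction (sym eq) (All.lookup x∉ (∈-lookup i))
lookup-injective (_ ∷ u) {suc i} {suc j} eq = cong suc (lookup-injective u eq)

unique⇒length≤ : {xs : List (Fin n)} → Unique xs → length xs ≤ n
unique⇒length≤ u = injective⇒≤ (lookup-injective u)

module _ {P : Pred (Fin n) 0ℓ} (P? : Decidable P) where

  injection⇒≤count : (f : Fin k → Fin n) → (∀ i → P (f i)) → (∀ {i j} → f i ≡ f j → i ≡ j) →
    k ≤ length (filter P? (allFin n))
  injection⇒≤count f Pf inj = injective⇒≤ λ {i} {j} → inj ∘ index-injective (setoid _) (listed i) (listed j)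
    where
    listed : ∀ i → f i ∈ filter P? (allFin n)
    listed i = ∈-filter⁺ P? (∈-allFin (f i)) (Pf i)

  injection⇒count≤ : (f : Fin n → ℕ) → (∀ {x} → P x → f x < k) → (∀ {x y} → P x → P y → f x ≡ f y → x ≡ y) →
    length (filter P? (allFin n)) ≤ k
  injection⇒count≤ f bound inj = injective⇒≤ {f = λ i → fromℕ< (bound (P-at i))} λ {i} {j} eq →
    lookup-injective (filter⁺ P? (allFin⁺ n))
      (inj (P-at i) (P-at j) (fromℕ<-injective _ _ _ _ eq))
    where
    P-at : ∀ i → P (lookup (filter P? (allFin n)) i)
    P-at i = proj₂ (∈-filter⁻ P? {xs = allFin n} (∈-lookup i))

++-comparable : ∀ {A : Set} (us vs : List A) {xs ys} → us ++ xs ≡ vs ++ ys →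
  (∃[ ws ] ws ++ xs ≡ ys) ⊎ (∃[ ws ] ws ++ ys ≡ xs)
++-comparable []       vs       eq = inj₂ (vs , sym eq)
++-comparable us@(_ ∷ _) []     eq = inj₁ (us , eq)
++-comparable (u ∷ us) (v ∷ vs) eq = ++-comparable us vs (∷-injectiveʳ eq)

unique-rotate : ∀ {A : Set} {x : A} ys {zs} → Unique (ys ++ x ∷ zs) → Unique (x ∷ ys)
unique-rotate []       _        = [] ∷ []
unique-rotate (y ∷ ys) (y∉ ∷ u) with unique-rotate ys u | ++⁻ ys y∉
... | x∉ys ∷ u′ | y∉ys , (y≢x ∷ _) = ((y≢x ∘ sym) ∷ x∉ys) ∷ y∉ys ∷ u′

linked-prefix : ∀ {A : Set} {R : Rel A 0ℓ} {x} ys {zs} → Linked R (ys ++ x ∷ zs) → Linked R (ys ∷ʳ x)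
linked-prefix []           _       = [-]
linked-prefix (_ ∷ [])     (r ∷ _) = r ∷ [-]
linked-prefix (_ ∷ y ∷ ys) (r ∷ l) = r ∷ linked-prefix (y ∷ ys) l

unique-ʳ++⁻ : ∀ {A : Set} (ps : List A) {qs} → Unique (ps ʳ++ qs) → Unique qs
unique-ʳ++⁻ []       u = u
unique-ʳ++⁻ (p ∷ ps) u with unique-ʳ++⁻ ps u
... | _ ∷ u′ = u′

unique-ʳ++⇒disjoint : ∀ {A : Set} {x : A} ps {qs} → Unique (ps ʳ++ qs) → x ∈ ps → x ∈ qs → ⊥
unique-ʳ++⇒disjoint (p ∷ ps) u (here refl) x∈qs with unique-ʳ++⁻ ps u
... | x∉ ∷ _ = All.lookup x∉ x∈qs refl
unique-ʳ++⇒disjoint (p ∷ ps) u (there x∈ps) x∈qs = unique-ʳ++⇒disjoint ps u x∈ps (there x∈qs)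

-- Paths are listed from the far vertex back to the root `r`, so that prolonging one away from `r`
-- is a cons.
data EndsIn {A : Set} (r : A) : List A → Set where
  end  : EndsIn r (r ∷ [])
  skip : ∀ {x xs} → EndsIn r xs → EndsIn r (x ∷ xs)

endsIn⇒∈ : ∀ {A : Set} {r : A} {xs} → EndsIn r xs → r ∈ xs
endsIn⇒∈ end      = here refl
endsIn⇒∈ (skip e) = there (endsIn⇒∈ e)

endsIn-singleton : ∀ {A : Set} {r x : A} → EndsIn r (x ∷ []) → x ≡ r
endsIn-singleton end = refl

endsIn-++ : ∀ {A : Set} {r : A} ys {xs} → EndsIn r xs → EndsIn r (ys ++ xs)
endsIn-++ []       e = e
endsIn-++ (_ ∷ ys) e = skip (endsIn-++ ys e)

-- Paths in trees

module GraphProperties (G : Graph) where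
  open Graph G

  degree≡1⇒neighbour-unique : ∀ {x y z} → degree x ≡ 1 → Adj x y → Adj x z → y ≡ z
  degree≡1⇒neighbour-unique {x} {y} {z} deg xy xz = decidable-stable (y ≟ z) λ y≢z →
    ℕ.<-irrefl (sym deg) (subst (_< degree x) (∣⁅x⁆∣≡1 y) (p⊂q⇒∣p∣<∣q∣
      ( (λ v∈ → subst (_∈ˢ tabulate (adj x)) (sym (x∈⁅y⁆⇒x≡y y v∈)) (∈-tabulate⁺ xy))
      , z , ∈-tabulate⁺ xz , y≢z ∘ sym ∘ x∈⁅y⁆⇒x≡y y )))

  neighbour-unique⇒degree≡1 : ∀ {x y} → Adj x y → (∀ {z} → Adj x z → z ≡ y) → degree x ≡ 1
  neighbour-unique⇒degree≡1 {x} {y} xy uniq = trans (cong ∣_∣ (⊆-antisym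
    (λ v∈ → subst (_∈ˢ ⁅ y ⁆) (sym (uniq (∈-tabulate⁻ v∈))) (x∈⁅x⁆ y))
    (λ v∈ → subst (_∈ˢ tabulate (adj x)) (sym (x∈⁅y⁆⇒x≡y y v∈)) (∈-tabulate⁺ xy)))) (∣⁅x⁆∣≡1 y)

  -- A local condition, easy to keep when walks are glued or prolonged; in an acyclic graph it
  -- forces distinct vertices.
  data NonBacktracking : List Vertex → Set where
    point : ∀ {x} → NonBacktracking (x ∷ [])
    edge  : ∀ {x y} → Adj x y → NonBacktracking (x ∷ y ∷ [])
    step  : ∀ {x y z zs} → x ≢ z → Adj x y → NonBacktracking (y ∷ z ∷ zs) → NonBacktracking (x ∷ y ∷ z ∷ zs)

  nb-tail : ∀ {x y ys} → NonBacktracking (x ∷ y ∷ ys) → NonBacktracking (y ∷ ys)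
  nb-tail (edge _)      = point
  nb-tail (step _ _ nb) = nb

  nb-head : ∀ {x y ys} → NonBacktracking (x ∷ y ∷ ys) → Adj x y
  nb-head (edge xy)     = xy
  nb-head (step _ xy _) = xy

  nb⇒linked : ∀ {xs} → NonBacktracking xs → Linked Adj xs
  nb⇒linked point          = [-]
  nb⇒linked (edge xy)      = xy ∷ [-]
  nb⇒linked (step _ xy nb) = xy ∷ nb⇒linked nb

  module _ (acyclic : Acyclic) where

    -- A return after one step is a loop, after two steps a backtrack, and any later one closes a
    -- cycle.
    nb-no-return : ∀ {x xs} → NonBacktracking (x ∷ xs) → Unique xs → ¬ x ∈ xs
    nb-no-return nb _ (here refl) = irreflexive refl (nb-head nb)
    nb-no-return (step x≢z _ _) _ (there (here x≡z)) = x≢z x≡z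
    nb-no-return nb@(step {x} {y} {z} _ _ _) u (there (there x∈)) with ∈-∃++ x∈
    ... | ys , _ , refl = acyclic x y z ys
      (unique-rotate (y ∷ z ∷ ys) u , linked-prefix (x ∷ y ∷ z ∷ ys) (nb⇒linked nb))

    nb⇒unique : ∀ {xs} → NonBacktracking xs → Unique xs
    nb⇒unique {_ ∷ []} _ = [] ∷ []
    nb⇒unique {_ ∷ _ ∷ _} nb with nb⇒unique (nb-tail nb)
    ... | u = ¬Any⇒All¬ _ (nb-no-return nb u) ∷ u

    -- The second walk is reversed and glued on along the shared edge between `y` and `z`, which
    -- excludes a reversal at the joint.
    nb-ʳ++ : ∀ ps {y z qs} → NonBacktracking (y ∷ z ∷ qs) → NonBacktracking (z ∷ y ∷ ps) →
      NonBacktracking (ps ʳ++ (y ∷ z ∷ qs))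
    nb-ʳ++ []       nb _ = nb
    nb-ʳ++ (x ∷ ps) nb (step z≢x _ nb′) =
      nb-ʳ++ ps (step (z≢x ∘ sym) (symmetric (nb-head nb′)) nb) nb′

    nb-path-unique : ∀ {r x ps qs} → NonBacktracking (x ∷ ps) → NonBacktracking (x ∷ qs) →
      EndsIn r (x ∷ ps) → EndsIn r (x ∷ qs) → ps ≡ qs
    nb-path-unique {ps = []} {[]} _ _ _ _ = refl
    nb-path-unique {ps = []} {_ ∷ _} _ nbq end (skip eq) =
      contradiction (endsIn⇒∈ eq) (nb-no-return nbq (nb⇒unique (nb-tail nbq)))
    nb-path-unique {ps = _ ∷ _} {[]} nbp _ (skip ep) end =
      contradiction (endsIn⇒∈ ep) (nb-no-return nbp (nb⇒unique (nb-tail nbp)))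
    nb-path-unique {ps = y ∷ ps} {z ∷ qs} nbp nbq (skip ep) (skip eq) with y ≟ z
    ... | yes refl = cong (y ∷_) (nb-path-unique (nb-tail nbp) (nb-tail nbq) ep eq)
    -- Two different last steps glue to a nonbacktracking closed walk at r.
    ... | no y≢z = ⊥-elim (unique-ʳ++⇒disjoint (y ∷ ps)
      (nb⇒unique (nb-ʳ++ ps (step y≢z (symmetric (nb-head nbp)) nbq) nbp))
      (endsIn⇒∈ ep) (there (endsIn⇒∈ eq)))

    PathWithin : (Vertex → Set) → Vertex → Vertex → List Vertex → Set
    PathWithin S r x xs = NonBacktracking (x ∷ xs) × EndsIn r (x ∷ xs) × All S (x ∷ xs)

    -- Each step of the walk either undoes the last edge of the path built so far or is added to it;
    -- neither leaves `S`.
    reduce : ∀ {S : Vertex → Set} {R : Rel Vertex 0ℓ} →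
      (∀ {x y} → R x y → Adj x y) → (∀ {x y} → R x y → S y) →
      ∀ {r x y xs} → PathWithin S r x xs → Star R x y → ∃ (PathWithin S r y)
    reduce R⇒Adj R⇒S p ε = _ , p
    reduce R⇒Adj R⇒S {xs = []} (_ , end , sx ∷ _) (xy ◅ w) =
      reduce R⇒Adj R⇒S (edge (symmetric (R⇒Adj xy)) , skip end , R⇒S xy ∷ sx ∷ []) w
    reduce R⇒Adj R⇒S {x = x} {xs = z ∷ _} (nb , skip e , sx ∷ s) (_◅_ {j = y} xy w) with y ≟ z
    ... | yes refl = reduce R⇒Adj R⇒S (nb-tail nb , e , s) w
    ... | no y≢z = reduce R⇒Adj R⇒S (step y≢z (symmetric (R⇒Adj xy)) nb , skip (skip e) , R⇒S xy ∷ sx ∷ s) w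

    -- Away from a leaf there is a neighbour other than `x` to continue to. The vertices stay
    -- distinct, so at most `order` of them occur, and the fuel `k` cannot run out.
    extend-to-leaf : ∀ k {y x xs} → order < length (y ∷ x ∷ xs) + k → NonBacktracking (y ∷ x ∷ xs) →
      ∃[ ys ] ∃[ ℓ ] ∃[ zs ] ys ++ (y ∷ x ∷ xs) ≡ ℓ ∷ zs × NonBacktracking (ℓ ∷ zs) × degree ℓ ≡ 1
    extend-to-leaf zero {y} {x} {xs} order< nb = contradiction (unique⇒length≤ (nb⇒unique nb))
      (ℕ.<⇒≱ (subst (order <_) (ℕ.+-identityʳ _) order<))
    extend-to-leaf (suc k) {y} {x} {xs} order< nb with any? (λ z → T? (adj y z) ×-dec ¬? (z ≟ x))
    ... | no none = [] , y , x ∷ xs , refl , nb ,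
      neighbour-unique⇒degree≡1 (nb-head nb) λ {z} yz → decidable-stable (z ≟ x) λ z≢x → none (z , yz , z≢x)
    ... | yes (z , yz , z≢x) with extend-to-leaf k
          (subst (order <_) (ℕ.+-suc (length (y ∷ x ∷ xs)) k) order<) (step z≢x (symmetric yz) nb)
    ... | ys , ℓ , zs , eq , nb′ , deg = ys ∷ʳ z , ℓ , zs , trans (∷ʳ-++ ys z _) eq , nb′ , deg

-- Lower bound: antichains and leaves

module _ {D : Digraph} {H : Tree} (rep : CatchRepresentation D H) where
  open Digraph D using (Vertex; Edge)
  open Tree H hiding (Vertex)
  open GraphProperties graph
  open CatchRepresentation rep

  antichain≤leafCount : (m : Vertex) → (∀ {u v} → Edge u v → Edge u m) →
    (a : Fin k → Vertex) → (∀ {i j} → i ≢ j → ¬ (∀ {u} → Edge u (a i) → Edge u (a j))) →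
    2 ≤ k → k ≤ leafCount
  antichain≤leafCount {k} m m-top a antichain 2≤k =
    injection⇒≤count (λ x → degree x ℕ.≟ 1) leaf leaf-degree leaf-injective
    where
    r : Graph.Vertex graph
    r = sink m

    s : Fin k → Graph.Vertex graph
    s i = sink (a i)

    path : ∀ i → ∃ (PathWithin acyclic (λ _ → ⊤) r (s i))
    path i = reduce acyclic id (λ _ → _) (point , end , _ ∷ []) (connected r (s i))

    -- Every source subtree caught at s j is also caught at r, so it contains
    -- the whole path between them.
    on-path⇒≡ : ∀ {i j} → s i ∈ s j ∷ proj₁ (path j) → i ≡ j
    on-path⇒≡ {i} {j} si∈ = decidable-stable (i ≟ j) λ i≢j → antichain (i≢j ∘ sym) λ {u} u→aj →
      let S = source u
          S-path = reduce acyclic {S = _∈ˢ Subtree.vertices S} (Subtree.adj⇒adj S)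
                     (Subtree.adj⇒∈ S ∘ Subtree.symmetric S)
                     (point , end , to (catch u m) (m-top u→aj) ∷ [])
                     (Subtree.connected S (to (catch u m) (m-top u→aj)) (to (catch u (a j)) u→aj))
          nbʲ , endʲ , _ = proj₂ (path j)
          nbˢ , endˢ , inS = proj₂ S-path
      in from (catch u (a i)) (All.lookup inS
           (subst (λ ps → s i ∈ s j ∷ ps) (nb-path-unique acyclic nbʲ nbˢ endʲ endˢ) si∈))

    other : (i : Fin k) → ∃[ j ] j ≢ i
    other = at 2≤k
      where
      at : ∀ {k} → 2 ≤ k → (i : Fin k) → ∃[ j ] j ≢ i
      at (s≤s (s≤s _)) zero    = suc zero , λ ()
      at (s≤s (s≤s _)) (suc i) = zero , λ ()

    -- A sink at `r` would lie on the path of every other member, and `2 ≤ k` provides one. Hence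
    -- each path has an edge from which it can be prolonged.
    s≢r : ∀ i → s i ≢ r
    s≢r i eq with other i
    ... | j , j≢i = j≢i (sym (on-path⇒≡ (subst (_∈ s j ∷ proj₁ (path j)) (sym eq)
      (endsIn⇒∈ (proj₁ (proj₂ (proj₂ (path j))))))))

    Extends : Fin k → List (Graph.Vertex graph) → Graph.Vertex graph → List (Graph.Vertex graph) → Set
    Extends i ys ℓ zs = ys ++ (s i ∷ proj₁ (path i)) ≡ ℓ ∷ zs × NonBacktracking (ℓ ∷ zs) × degree ℓ ≡ 1

    extension : ∀ i → ∃[ ys ] ∃[ ℓ ] ∃ (Extends i ys ℓ)
    extension i with path i
    ... | [] , _ , e , _ = contradiction (endsIn-singleton e) (s≢r i)
    ... | _ ∷ _ , nb , _ , _ = extend-to-leaf acyclic order (s≤s (ℕ.m≤n+m order _)) nb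

    leaf : Fin k → Graph.Vertex graph
    leaf i = proj₁ (proj₂ (extension i))

    leaf-degree : ∀ i → degree (leaf i) ≡ 1
    leaf-degree i = proj₂ (proj₂ (proj₂ (proj₂ (proj₂ (extension i)))))

    leaf-injective : ∀ {i j} → leaf i ≡ leaf j → i ≡ j
    leaf-injective {i} {j} = same-end (proj₂ (proj₂ (proj₂ (extension i)))) (proj₂ (proj₂ (proj₂ (extension j))))
      where
      -- Both prolonged paths join the common leaf to `r`, so they coincide. The original paths are
      -- then nested final segments, and one of the sinks lies on the path of the other.
      same-end : ∀ {i j ysᵢ ysⱼ ℓᵢ ℓⱼ zsᵢ zsⱼ} → Extends i ysᵢ ℓᵢ zsᵢ → Extends j ysⱼ ℓⱼ zsⱼ → ℓᵢ ≡ ℓⱼ → i ≡ j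
      same-end {i} {j} {ysᵢ} {ysⱼ} (eqᵢ , nbᵢ , _) (eqⱼ , nbⱼ , _) refl
        with refl ← nb-path-unique acyclic nbᵢ nbⱼ
               (subst (EndsIn r) eqᵢ (endsIn-++ ysᵢ (proj₁ (proj₂ (proj₂ (path i))))))
               (subst (EndsIn r) eqⱼ (endsIn-++ ysⱼ (proj₁ (proj₂ (proj₂ (path j))))))
        with ++-comparable ysᵢ ysⱼ (trans eqᵢ (sym eqⱼ))
      ... | inj₁ (ws , eq) = on-path⇒≡ (subst (s i ∈_) eq (∈-++⁺ʳ ws (here refl)))
      ... | inj₂ (ws , eq) = sym (on-path⇒≡ (subst (s j ∈_) eq (∈-++⁺ʳ ws (here refl))))

-- Host trees given by parents

-- `y ⋖ x` means that `y` is the parent of `x`. Numbers grow away from the root `zero`.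
module ParentTree {n : ℕ} {_⋖_ : Rel (Fin (suc n)) 0ℓ} (_⋖?_ : B.Decidable _⋖_)
  (⋖⇒< : ∀ {x y} → x ⋖ y → toℕ x < toℕ y)
  (⋖-functional : ∀ {x y z} → x ⋖ z → y ⋖ z → x ≡ y)
  (parent : ∀ x → x ≢ zero → ∃[ y ] y ⋖ x) where

  Node : Set
  Node = Fin (suc n)

  _~_ : Rel Node 0ℓ
  x ~ y = x ⋖ y ⊎ y ⋖ x

  _~?_ : B.Decidable _~_
  x ~? y = (x ⋖? y) ⊎-dec (y ⋖? x)

  graph : Graph
  graph = record
    { order       = suc n
    ; adj         = λ x y → isYes (x ~? y)
    ; symmetric   = fromWitness ∘ swap ∘ toWitness
    ; irreflexive = λ { refl → irrefl ∘ toWitness }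
    }
    where
    irrefl : ∀ {x} → ¬ x ~ x
    irrefl (inj₁ x⋖x) = ℕ.<-irrefl refl (⋖⇒< x⋖x)
    irrefl (inj₂ x⋖x) = ℕ.<-irrefl refl (⋖⇒< x⋖x)

  open Graph graph using (Adj; Acyclic)

  adj⇒~ : ∀ {x y} → Adj x y → x ~ y
  adj⇒~ {x} {y} = toWitness {a? = x ~? y}

  ~⇒adj : ∀ {x y} → x ~ y → Adj x y
  ~⇒adj {x} {y} = fromWitness {a? = x ~? y}

  -- After a child step, a parent step would return to x because parents are
  -- unique, so a walk that never turns back keeps going to children.
  ascending : ∀ {e x y} zs → x ⋖ y → All (_≢ e) (x ∷ y ∷ zs) → Unique (x ∷ y ∷ zs) →
    Linked Adj (y ∷ zs ∷ʳ e) → toℕ y < toℕ e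
  ascending [] x⋖y (x≢e ∷ _) _ (ye ∷ [-]) with adj⇒~ ye
  ... | inj₁ y⋖e = ⋖⇒< y⋖e
  ... | inj₂ e⋖y = contradiction (⋖-functional x⋖y e⋖y) x≢e
  ascending (z ∷ zs) x⋖y (_ ∷ ≢e) ((_ ∷ x≢z ∷ _) ∷ u) (yz ∷ l) with adj⇒~ yz
  ... | inj₁ y⋖z = ℕ.<-trans (⋖⇒< y⋖z) (ascending zs y⋖z ≢e u l)
  ... | inj₂ z⋖y = contradiction (⋖-functional x⋖y z⋖y) x≢z

  -- The walk goes to parents first and to children afterwards. Either it never turns to children,
  -- or its last step reaches `e` from the parent of `e`.
  descending : ∀ {e y z} zs → All (_≢ e) (y ∷ z ∷ zs) → Unique (y ∷ z ∷ zs) →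
    Linked Adj (y ∷ z ∷ zs ∷ʳ e) → toℕ e < toℕ y ⊎ (∃[ u ] u ∈ z ∷ zs × u ⋖ e)
  descending {e} {y} {z} zs ≢e u (yz ∷ l) with adj⇒~ yz | later zs ≢e u l
    where
    later : ∀ zs → All (_≢ e) (y ∷ z ∷ zs) → Unique (y ∷ z ∷ zs) → Linked Adj (z ∷ zs ∷ʳ e) →
      toℕ e < toℕ z ⊎ (∃[ u ] u ∈ z ∷ zs × u ⋖ e)
    later [] _ _ (ze ∷ [-]) with adj⇒~ ze
    ... | inj₁ z⋖e = inj₂ (z , here refl , z⋖e)
    ... | inj₂ e⋖z = inj₁ (⋖⇒< e⋖z)
    later (t ∷ ts) (_ ∷ ≢e) (_ ∷ u) l with descending ts ≢e u l
    ... | inj₁ e<z = inj₁ e<z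
    ... | inj₂ (v , v∈ , v⋖e) = inj₂ (v , there v∈ , v⋖e)
  ... | _        | inj₂ found = inj₂ found
  ... | inj₂ z⋖y | inj₁ e<z   = inj₁ (ℕ.<-trans e<z (⋖⇒< z⋖y))
  ... | inj₁ y⋖z | inj₁ e<z   = contradiction (ascending zs y⋖z ≢e u l) (ℕ.<-asym e<z)

  -- If the cycle first goes to the parent `y` of `x`, it cannot end below `y`, and returning to `x`
  -- from its parent would visit `y` twice. If it first goes to a child, it keeps ascending and
  -- cannot close.
  acyclic : Acyclic
  acyclic x y z zs ((x∉ ∷ u@(y∉ ∷ u′)) , (xy ∷ l@(_ ∷ _)))
    with adj⇒~ xy | descending zs (All.map (_∘ sym) x∉) u l
  ... | inj₂ y⋖x | inj₁ x<y = ℕ.<-asym x<y (⋖⇒< y⋖x)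
  ... | inj₂ y⋖x | inj₂ (v , v∈ , v⋖x) = All.lookup y∉ v∈ (⋖-functional y⋖x v⋖x)
  acyclic x y z zs ((x∉@(_ ∷ x≢z ∷ _) ∷ u@(y∉ ∷ _)) , (xy ∷ yz ∷ l))
      | inj₁ x⋖y | _ with adj⇒~ yz
  ... | inj₁ y⋖z = ℕ.<-asym (ℕ.<-trans (⋖⇒< x⋖y) (⋖⇒< y⋖z)) (ascending zs y⋖z (All.map (_∘ sym) x∉) u l)
  ... | inj₂ z⋖y = x≢z (⋖-functional x⋖y z⋖y)

  module _ {S : Pred Node 0ℓ} (S-up : ∀ {x y} → y ⋖ x → S x → S y) where

    path-to-root : ∀ {x} → S x → Star (λ x y → x ~ y × S x × S y) x zero
    path-to-root {x} = go x (Fin.<-wellFounded x)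
      where
      go : ∀ x → Acc Fin._<_ x → S x → Star (λ x y → x ~ y × S x × S y) x zero
      go x (acc rs) sx with x ≟ zero
      ... | yes refl = ε
      ... | no x≢0 with parent x x≢0
      ... | y , y⋖x = (inj₂ y⋖x , sx , S-up y⋖x sx) ◅ go y (rs (⋖⇒< y⋖x)) (S-up y⋖x sx)

    connect-via-root : ∀ {x y} → S x → S y → Star (λ x y → x ~ y × S x × S y) x y
    connect-via-root sx sy = path-to-root sx ◅◅
      Star.reverse (λ (xy , sx , sy) → swap xy , sy , sx) (path-to-root sy)

  tree : Tree
  tree = record
    { graph     = graph
    ; connected = λ x y → Star.map (~⇒adj ∘ proj₁) (connect-via-root {S = λ _ → ⊤} _ {x} {y} _ _)
    ; acyclic   = acyclic
    }

  module _ {S : Pred Node 0ℓ} (S? : Decidable S) (S-root : S zero)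
    (S-up : ∀ {x y} → y ⋖ x → S x → S y) where

    S-adj? : B.Decidable (λ x y → x ~ y × S x × S y)
    S-adj? x y = (x ~? y) ×-dec S? x ×-dec S? y

    vertex⁺ : ∀ {x} → S x → x ∈ˢ tabulate (isYes ∘ S?)
    vertex⁺ {x} sx = ∈-tabulate⁺ {f = isYes ∘ S?} (fromWitness {a? = S? x} sx)

    vertex⁻ : ∀ {x} → x ∈ˢ tabulate (isYes ∘ S?) → S x
    vertex⁻ {x} x∈ = toWitness {a? = S? x} (∈-tabulate⁻ {f = isYes ∘ S?} x∈)

    rooted-subtree : Subtree tree
    rooted-subtree = record
      { vertices  = tabulate (isYes ∘ S?)
      ; adj       = λ x y → isYes (S-adj? x y)
      ; symmetric = λ {x} {y} a → let xy , sx , sy = toWitness {a? = S-adj? x y} a in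
                      fromWitness {a? = S-adj? y x} (swap xy , sy , sx)
      ; adj⇒∈     = λ {x} {y} a → vertex⁺ (proj₁ (proj₂ (toWitness {a? = S-adj? x y} a)))
      ; adj⇒adj   = λ {x} {y} a → ~⇒adj (proj₁ (toWitness {a? = S-adj? x y} a))
      ; nonempty  = zero , vertex⁺ S-root
      ; connected = λ x∈ y∈ → Star.map (λ {x} {y} → fromWitness {a? = S-adj? x y})
                      (connect-via-root S-up (vertex⁻ x∈) (vertex⁻ y∈))
      }

-- The spider with w legs of length suc d: the body is 0, and p > 0 lies on
-- leg (p − 1) mod w with its neighbour towards the body at p ∸ w.
module Spider (w d : ℕ) (2≤w : 2 ≤ w) where

  instance
    w≢0 : NonZero w
    w≢0 = ℕ.>-nonZero (ℕ.<-trans (s≤s z≤n) 2≤w)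

  size : ℕ
  size = d * w + w

  -- Truncated subtraction gives the first `w` nodes the body as parent; the strict inequality keeps
  -- the body from being its own parent.
  _⋖_ : Rel (Fin (suc size)) 0ℓ
  y ⋖ x = toℕ y < toℕ x × toℕ y ≡ toℕ x ∸ w

  ∸w< : ∀ {p} → 0 < p → p ∸ w < p
  ∸w< {suc p} _ = ℕ.≤-<-trans (ℕ.∸-monoʳ-≤ (suc p) (ℕ.>-nonZero⁻¹ w)) ℕ.≤-refl

  ≢0⇒>0 : ∀ {x : Fin (suc size)} → x ≢ zero → 0 < toℕ x
  ≢0⇒>0 {zero}  x≢0 = contradiction refl x≢0
  ≢0⇒>0 {suc _} _   = s≤s z≤n

  parent : ∀ x → x ≢ zero → ∃[ y ] y ⋖ x
  parent x x≢0 = fromℕ< y< , subst (_< toℕ x) (sym y≡) (∸w< (≢0⇒>0 x≢0)) , y≡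
    where
    y< : toℕ x ∸ w < suc size
    y< = ℕ.≤-<-trans (ℕ.m∸n≤m (toℕ x) w) (toℕ<n x)
    y≡ : toℕ (fromℕ< y<) ≡ toℕ x ∸ w
    y≡ = toℕ-fromℕ< y<

  open ParentTree {_⋖_ = _⋖_} (λ y x → (toℕ y ℕ.<? toℕ x) ×-dec (toℕ y ℕ.≟ toℕ x ∸ w))
    proj₁ (λ (_ , eq) (_ , eq′) → toℕ-injective (trans eq (sym eq′))) parent public

  open GraphProperties graph using (degree≡1⇒neighbour-unique; neighbour-unique⇒degree≡1)
  open Tree tree using (degree; leafCount)

  child : ∀ x → 0 < toℕ x → toℕ x ≤ d * w → ∃[ y ] x ⋖ y
  child x x>0 x≤ = fromℕ< y< , subst (toℕ x <_) (sym y≡) (ℕ.m<m+n (toℕ x) (ℕ.>-nonZero⁻¹ w)) ,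
    sym (trans (cong (_∸ w) y≡) (ℕ.m+n∸n≡m (toℕ x) w))
    where
    y< : toℕ x + w < suc size
    y< = s≤s (ℕ.+-monoˡ-≤ w x≤)
    y≡ : toℕ (fromℕ< y<) ≡ toℕ x + w
    y≡ = toℕ-fromℕ< y<

  ⋖⇒+w : ∀ {x y} → 0 < toℕ y → y ⋖ x → toℕ x ≡ toℕ y + w
  ⋖⇒+w {x} {y} y>0 (_ , eq) = sym (trans (cong (_+ w) eq)
    (ℕ.m∸n+n≡m (ℕ.<⇒≤ (ℕ.m∸n≢0⇒n<m {toℕ x} {w} λ x∸w≡0 → ℕ.<⇒≢ y>0 (sym (trans eq x∸w≡0))))))

  -- A child would have the number `toℕ x + w`, which exceeds `size`.
  outermost⇒degree≡1 : ∀ {x} → d * w < toℕ x → degree x ≡ 1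
  outermost⇒degree≡1 {x} x> with parent x (λ { refl → ℕ.n≮0 x> })
  ... | y , y⋖x = neighbour-unique⇒degree≡1 (~⇒adj (inj₂ y⋖x)) (only ∘ adj⇒~)
    where
    only : ∀ {z} → x ~ z → z ≡ y
    only {z} (inj₁ x⋖z) = contradiction (toℕ<n z) (ℕ.≤⇒≯ (subst (suc size ≤_) (sym (⋖⇒+w (ℕ.m<n⇒0<n x>) x⋖z)) (ℕ.+-monoˡ-< w x>)))
    only (inj₂ (_ , eq)) = toℕ-injective (trans eq (sym (proj₂ y⋖x)))

  -- The body has the children 1 and 2 because `2 ≤ w`; any other inner node has a parent and a
  -- child.
  degree≡1⇒outermost : ∀ {x} → degree x ≡ 1 → d * w < toℕ x
  degree≡1⇒outermost {x} deg = ℕ.≰⇒> (inner x deg)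
    where
    first : ∀ {p} → 0 < p → p ≤ w → ∃[ y ] toℕ y ≡ p × zero ⋖ y
    first {p} p>0 p≤w = fromℕ< p< , p≡ , subst (0 <_) (sym p≡) p>0 ,
      sym (trans (cong (_∸ w) p≡) (ℕ.m≤n⇒m∸n≡0 p≤w))
      where
      p< : p < suc size
      p< = s≤s (ℕ.≤-trans p≤w (ℕ.m≤n+m w (d * w)))
      p≡ : toℕ (fromℕ< p<) ≡ p
      p≡ = toℕ-fromℕ< p<
    inner : ∀ x → degree x ≡ 1 → ¬ toℕ x ≤ d * w
    inner zero deg _ with first {1} (s≤s z≤n) (ℕ.<⇒≤ 2≤w) | first {2} (s≤s z≤n) 2≤w
    ... | y , y≡1 , 0⋖y | z , z≡2 , 0⋖z
      with refl ← degree≡1⇒neighbour-unique deg (~⇒adj (inj₁ 0⋖y)) (~⇒adj (inj₁ 0⋖z))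
      with () ← trans (sym y≡1) z≡2
    inner x@(suc _) deg x≤ with parent x (λ ()) | child x (s≤s z≤n) x≤
    ... | y , y⋖x | z , x⋖z
      with refl ← degree≡1⇒neighbour-unique deg (~⇒adj (inj₂ y⋖x)) (~⇒adj (inj₁ x⋖z))
      = ℕ.<-asym (proj₁ y⋖x) (proj₁ x⋖z)

  leafCount≡w : leafCount ≡ w
  leafCount≡w = ℕ.≤-antisym
    (injection⇒count≤ leaf? (λ x → toℕ x ∸ suc (d * w))
      (λ {x} deg → ℕ.+-cancelˡ-< (suc (d * w)) _ _
        (subst (_< suc size) (sym (ℕ.m+[n∸m]≡n (degree≡1⇒outermost deg))) (toℕ<n x)))
      (λ degx degy eq → toℕ-injective
        (ℕ.∸-cancelʳ-≡ (degree≡1⇒outermost degx) (degree≡1⇒outermost degy) eq)))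
    (injection⇒≤count leaf? tip
      (λ i → outermost⇒degree≡1 (subst (d * w <_) (sym (tip≡ i)) (s≤s (ℕ.m≤m+n (d * w) _))))
      (λ {i} {j} eq → toℕ-injective (ℕ.+-cancelˡ-≡ (suc (d * w)) _ _
        (trans (sym (tip≡ i)) (trans (cong toℕ eq) (tip≡ j))))))
    where
    leaf? : Decidable (λ x → degree x ≡ 1)
    leaf? x = degree x ℕ.≟ 1
    tip< : (i : Fin w) → suc (d * w) + toℕ i < suc size
    tip< i = ℕ.+-monoʳ-< (suc (d * w)) (toℕ<n i)
    tip : Fin w → Fin (suc size)
    tip i = fromℕ< (tip< i)
    tip≡ : ∀ i → toℕ (tip i) ≡ suc (d * w) + toℕ i
    tip≡ i = toℕ-fromℕ< (tip< i)

  leg : Fin (suc size) → ℕ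
  leg x = pred (toℕ x) % w

  ⋖⇒same-leg : ∀ {x y} → y ≢ zero → y ⋖ x → leg y ≡ leg x
  ⋖⇒same-leg {x} {zero} y≢0 _ = contradiction refl y≢0
  ⋖⇒same-leg {x} {y@(suc _)} _ y⋖x = sym (trans
    (cong (λ p → pred p % w) (⋖⇒+w {x} {y} (s≤s z≤n) y⋖x)) ([m+n]%n≡m%n (pred (toℕ y)) w))

-- Upper bound: representation on a spider

module SpiderRepresentation (D : Digraph) {w : ℕ} (2≤w : 2 ≤ w) (c : Digraph.Vertex D → ℕ)
  (c< : ∀ v → c v < w)
  (chain : ∀ {u v} → c u ≡ c v → Digraph.N⁻ D u ⊆ Digraph.N⁻ D v ⊎ Digraph.N⁻ D v ⊆ Digraph.N⁻ D u) where

  open Digraph D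
  open Spider w order 2≤w

  -- Within a chain, cardinality decides inclusion. The values run from 0 to `order`, hence legs of
  -- length `suc order`.
  depth : Vertex → ℕ
  depth v = order ∸ ∣ N⁻ v ∣

  -- Otherwise `N⁻ v` would be a proper subset of `N⁻ u`, making `depth u` the smaller depth.
  deeper⇒⊆ : ∀ {u v} → c u ≡ c v → depth v ≤ depth u → N⁻ u ⊆ N⁻ v
  deeper⇒⊆ {u} {v} cu≡cv dv≤du with chain cu≡cv | N⁻ u ⊆? N⁻ v
  ... | _         | yes u⊆v = u⊆v
  ... | inj₁ u⊆v  | no _    = u⊆v
  ... | inj₂ v⊆u  | no u⊈v  = contradiction (ℕ.∸-cancelʳ-≤ (∣p∣≤n (N⁻ u)) dv≤du)
    (ℕ.<⇒≱ (p⊂q⇒∣p∣<∣q∣ (v⊆u , ⊈⇒∃ u⊈v)))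
    where
    ⊈⇒∃ : ¬ N⁻ u ⊆ N⁻ v → ∃[ x ] x ∈ˢ N⁻ u × ¬ x ∈ˢ N⁻ v
    ⊈⇒∃ u⊈v with any? (λ x → (x ∈ˢ? N⁻ u) ×-dec ¬? (x ∈ˢ? N⁻ v))
    ... | yes found = found
    ... | no none = contradiction (λ {x} x∈u → decidable-stable (x ∈ˢ? N⁻ v) λ x∉v → none (x , x∈u , x∉v)) u⊈v

  position : Vertex → ℕ
  position v = c v + depth v * w

  position< : ∀ v → suc (position v) < suc size
  position< v = s≤s (subst (_≤ size) (ℕ.+-comm (depth v * w) (suc (c v)))
    (ℕ.+-mono-≤ (ℕ.*-monoˡ-≤ w (ℕ.m∸n≤m order ∣ N⁻ v ∣)) (c< v)))

  sink : Vertex → Fin (suc size)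
  sink v = fromℕ< (position< v)

  sink≡ : ∀ v → toℕ (sink v) ≡ suc (position v)
  sink≡ v = toℕ-fromℕ< (position< v)

  sink-leg : ∀ v → leg (sink v) ≡ c v
  sink-leg v = trans (cong (λ p → pred p % w) (sink≡ v))
    (trans ([m+kn]%n≡m%n (c v) (depth v) w) (m<n⇒m%n≡m (c< v)))

  -- The body is always included, so the subtree is nonempty and connected; no sink lies there.
  Caught : Vertex → Fin (suc size) → Set
  Caught u x = x ≡ zero ⊎ (∃[ v ] Edge u v × toℕ x ≤ toℕ (sink v) × leg x ≡ c v)

  caught? : ∀ u → Decidable (Caught u)
  caught? u x = (x ≟ zero) ⊎-dec
    any? (λ v → T? (edge u v) ×-dec (toℕ x ℕ.≤? toℕ (sink v)) ×-dec (leg x ℕ.≟ c v))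

  caught-up : ∀ u {x y} → y ⋖ x → Caught u x → Caught u y
  caught-up u {x} {y} y⋖x caught with y ≟ zero
  ... | yes y≡0 = inj₁ y≡0
  caught-up u (() , _) (inj₁ refl) | no _
  caught-up u {x} {y} y⋖x (inj₂ (v , uv , x≤ , leg≡)) | no y≢0 =
    inj₂ (v , uv , ℕ.≤-trans (ℕ.<⇒≤ (proj₁ y⋖x)) x≤ , trans (⋖⇒same-leg {x} {y} y≢0 y⋖x) leg≡)

  caught⇒edge : ∀ {u v} → Caught u (sink v) → Edge u v
  caught⇒edge {v = v} (inj₁ eq) with () ← trans (sym (sink≡ v)) (cong toℕ eq)
  caught⇒edge {u} {v} (inj₂ (v′ , uv′ , v≤v′ , leg≡)) =
    ∈-tabulate⁻ (deeper⇒⊆ (sym cv≡cv′) depth≤ (∈-tabulate⁺ uv′))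
    where
    cv≡cv′ : c v ≡ c v′
    cv≡cv′ = trans (sym (sink-leg v)) leg≡
    depth≤ : depth v ≤ depth v′
    depth≤ = ℕ.*-cancelʳ-≤ (depth v) (depth v′) w (ℕ.+-cancelˡ-≤ (c v) _ _
      (subst (position v ≤_) (cong (_+ depth v′ * w) (sym cv≡cv′))
        (ℕ.≤-pred (subst₂ _≤_ (sink≡ v) (sink≡ v′) v≤v′))))

  representation : CatchRepresentation D tree
  representation = record
    { source = λ u → rooted-subtree (caught? u) (inj₁ refl) (caught-up u)
    ; sink   = sink
    ; catch  = λ u v → mk⇔
        (λ uv → vertex⁺ (caught? u) (inj₁ refl) (caught-up u) (inj₂ (v , uv , ℕ.≤-refl , sink-leg v)))
        (λ v∈ → caught⇒edge (vertex⁻ (caught? u) (inj₁ refl) (caught-up u) v∈))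
    }

-- The incidence poset and the final assembly

module IncidencePoset (D : Digraph) where

  open Digraph D
  -- Vertices stand for their predecessor sets; as these may be equal, inclusion is only a preorder
  -- on vertices.
  open FinitePreorder {order} {λ u v → N⁻ u ⊆ N⁻ v} (λ u v → N⁻ u ⊆? N⁻ v) ⊆-refl ⊆-trans public

  element : Vertex → Poset.Carrier (incidencePoset D)
  element v = N⁻ v , v , refl

  -- By finiteness every predecessor set lies below a maximal one, which must be the unique one.
  unique-maximal⇒greatest : HasUniqueMaximal (incidencePoset D) →
    ∃[ m ] (∀ {u v} → Edge u v → Edge u m)
  unique-maximal⇒greatest ((_ , m , refl) , _ , unique) = m , λ {u} {v} uv → greatest v uv
    where
    greatest : ∀ v {u} → Edge u v → Edge u m
    greatest v uv with maximal (λ y → N⁻ v ⊆? N⁻ y) (v , ⊆-refl) (allFin order)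
    ... | t , v⊆t , t-max = ∈-tabulate⁻ (subst (_ ∈ˢ_)
      (sym (unique {element t} λ { (_ , y , refl) t⊆y →
        ⊆-antisym t⊆y (t-max (∈-allFin y) (⊆-trans v⊆t t⊆y) t⊆y) }))
      (v⊆t (∈-tabulate⁺ uv)))

theorem9 : (D : Digraph) (w : ℕ) →
    HasUniqueMaximal (incidencePoset D) →
    IsWidth (incidencePoset D) w →
    2 ≤ w →
    IsCatchLeafage D w
theorem9 D w unique-max ((a , a-anti) , width) 2≤w
  with m , m-top ← IncidencePoset.unique-maximal⇒greatest D unique-max
  with k , (b , _ , b-anti) , c , c< , chain ← IncidencePoset.dilworth D (allFin (Digraph.order D)) =
  (tree , representation , leafCount≡w) ,
  λ H rep → antichain≤leafCount rep m m-top vertex a-incomparable 2≤w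
  where
  open Digraph D
  open IncidencePoset D
  -- This lets the `k` chains be placed on `w` legs.
  k≤w : k ≤ w
  k≤w = width k (element ∘ b , λ {i} {j} → b-anti i j)
  open Spider w order 2≤w using (tree; leafCount≡w)
  open SpiderRepresentation D 2≤w c (λ v → ℕ.<-≤-trans (c< (∈-allFin v)) k≤w)
    (λ {u} {v} → chain (∈-allFin u) (∈-allFin v)) using (representation)
  vertex : Fin w → Vertex
  vertex i = proj₁ (proj₂ (a i))
  a-incomparable : ∀ {i j} → i ≢ j → ¬ (∀ {u} → Edge u (vertex i) → Edge u (vertex j))
  a-incomparable {i} {j} i≢j i⊆j = a-anti i≢j (subst₂ _⊆_
    (sym (proj₂ (proj₂ (a i)))) (sym (proj₂ (proj₂ (a j)))) (∈-tabulate⁺ ∘ i⊆j ∘ ∈-tabulate⁻))
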